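{- Let $n\geq 3$ and $3\leq k\leq 2^{n-1}$ be integers. Then $$\kappa^s(Q_n;P_k)=\kappa(Q_n;P_k)=\begin{cases}\lceil \frac{2n}{k+1}\rceil & \text{if } k \text{ is odd},\\ \lceil \frac{2n}{k}\rceil & \text{if } k \text{ is even}.\end{cases}$$
   Context: $Q_n$ is the $n$-dimensional hypercube: its vertices are the binary strings of length $n$, two vertices being adjacent iff they differ in exactly one position. $P_k$ denotes the path with $k$ vertices (length $k-1$). For connected graphs $G,H$: an $H$-structure cut of $G$ is a set $F$ of subgraphs of $G$, each isomorphic to $H$, such that $G-V(F)$ (deleting all vertices of all members of $F$) is disconnected or trivial (a single vertex); an $H$-substructure cut is defined the same way except that each member of $F$ is isomorphic to a connected subgraph of $H$. The $H$-structure connectivity $\kappa(G;H)$ (resp. $H$-substructure connectivity $\kappa^s(G;H)$) is the minimum cardinality of an $H$-structure cut (resp. $H$-substructure cut) of $G$. -}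

module Defs where

open import Data.Nat using (ℕ; zero; suc; _+_; _*_; _∸_; _≤_)
open import Data.Nat.DivMod using (_/_; _%_)
open import Data.Bool using (Bool)
open import Data.Fin using (Fin; toℕ)
open import Data.Vec using (Vec; lookup)
open import Data.Vec.Membership.Propositional using (_∈_)
open import Data.List using (List; length)
open import Data.List.Relation.Unary.Any using (Any)
open import Data.Product using (Σ; _×_; _,_; ∃; ∃-syntax)
open import Data.Sum using (_⊎_)
open import Relation.Nullary using (¬_)
open import Relation.Binary.PropositionalEquality using (_≡_; _≢_)

record Graph : Set₁ where
  field
    Vertex : Set
    Adj    : Vertex → Vertex → Set
open Graph public

Q : ℕ → Graph
Q n = record
  { Vertex = Vec Bool n
  ; Adj    = λ u v → ∃[ i ] (lookup u i ≢ lookup v i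
                            × (∀ j → j ≢ i → lookup u j ≡ lookup v j))
  }

record PathIn (G : Graph) (j : ℕ) : Set where
  field
    verts    : Vec (Vertex G) j
    adjacent : ∀ (a b : Fin j) → toℕ b ≡ suc (toℕ a)
             → Adj G (lookup verts a) (lookup verts b)
    distinct : ∀ (a b : Fin j) → lookup verts a ≡ lookup verts b → a ≡ b
open PathIn public

-- A connected subgraph of P_k is (isomorphic to) some P_j with 1 ≤ j ≤ k.
SubPathIn : Graph → ℕ → Set
SubPathIn G k = Σ ℕ λ j → (1 ≤ j) × (j ≤ k) × PathIn G j

_∈Sub_ : ∀ {G k} → Vertex G → SubPathIn G k → Set
v ∈Sub (j , _ , _ , p) = v ∈ verts p

module _ (G : Graph) {A : Set} (memb : A → Vertex G → Set) (F : List A) where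

  Survives : Vertex G → Set
  Survives v = ¬ Any (λ a → memb a v) F

  data Reach : Vertex G → Vertex G → Set where
    here : ∀ {u} → Reach u u
    step : ∀ {u v w} → Adj G u v → Survives v → Reach v w → Reach u w

  Disconnected : Set
  Disconnected = ∃[ u ] ∃[ v ] (Survives u × Survives v × ¬ Reach u v)

  Trivial : Set
  Trivial = ∃[ u ] (Survives u × (∀ v → Survives v → v ≡ u))

  IsCut : Set
  IsCut = Disconnected ⊎ Trivial

IsPathStructureCut : (G : Graph) (k : ℕ) → List (PathIn G k) → Set
IsPathStructureCut G k F = IsCut G (λ p v → v ∈ verts p) F

IsPathSubstructureCut : (G : Graph) (k : ℕ) → List (SubPathIn G k) → Set
IsPathSubstructureCut G k F = IsCut G (λ s v → v ∈Sub s) F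

IsMinimum : {A : Set} → (List A → Set) → ℕ → Set
IsMinimum {A} C m =
  (Σ (List A) λ F → C F × length F ≡ m) × (∀ F → C F → m ≤ length F)

StructureConnectivity : Graph → ℕ → ℕ → Set
StructureConnectivity G k m = IsMinimum (IsPathStructureCut G k) m

SubstructureConnectivity : Graph → ℕ → ℕ → Set
SubstructureConnectivity G k m = IsMinimum (IsPathSubstructureCut G k) m

-- ceiling division ⌈ m / d ⌉ (junk value 0 for d = 0, never used)
ceilDiv : ℕ → ℕ → ℕ
ceilDiv m zero    = 0
ceilDiv m (suc d) = (m + d) / suc d

expected : ℕ → ℕ → ℕ
expected n k with k % 2
... | 0 = ceilDiv (2 * n) k
... | _ = ceilDiv (2 * n) (suc k)

{-# OPTIONS --safe #-}

-- Write c = ⌈k/2⌉; both cases of the formula say that the minimum is the least N with n ≤ N c.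
--
-- Lower bound. A path on at most k vertices has at most c vertices of each parity, so if N c < n
-- the deleted set S has at most n − 1 vertices of each parity. Any such S with |S| ≤ 2n − 3 leaves
-- the cube connected, by induction on n: the half-cube with fewer deleted vertices stays connected,
-- and every survivor w of the other half has a surviving neighbour x; the 2n − 2 neighbours of
-- w and x inside their half cannot all be blocked, so w escapes to the connected half. The only
-- remaining case is |S| = 2n − 2, where S contains a path p, q, r: split along the direction of pq,
-- which makes p and q project to the same vertex and gains the missing unit.
--
-- Upper bound. All neighbours of the origin lie on one long path avoiding the origin: it zigzags
-- through e_n, e_n + e_{n−1}, e_{n−1}, …, e_1, so that they occupy the even positions 0, …, 2n − 2,
-- and continues along a Hamiltonian cycle of the half-cube containing e_1. Windows of k consecutive
-- vertices, c neighbours apart, isolate the origin.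
module Submission where

open import Defs
open import Data.Bool using (Bool; true; false; not; _xor_)
import Data.Bool.Properties as Bool
open import Data.Fin using (Fin; zero; suc; toℕ; fromℕ<; splitAt; join; punchIn; punchOut)
import Data.Fin.Properties as Fin
open import Data.List using (List; []; _∷_; length; filter; map; _++_; concatMap; upTo)
import Data.List as List
open import Data.List.Properties
  using (filter-notAll; filter-accept; filter-reject; filter-++; length-filter; length-map; length-++;
         map-++; ++-assoc; length-upTo)
open import Data.List.Membership.Propositional using (_∈_; _∉_; find; lose)
open import Data.List.Membership.Propositional.Properties
  using (∈-map⁺; ∈-map⁻; ∈-++⁻; ∈-filter⁺; ∈-filter⁻; ∈-concatMap⁺; ∈-concatMap⁻; ∈-lookup; ∈-upTo⁺)
open import Data.List.Relation.Unary.All using (All; []; _∷_)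
import Data.List.Relation.Unary.All as All
open import Data.List.Relation.Unary.All.Properties using (¬Any⇒All¬)
open import Data.List.Relation.Unary.AllPairs using ([]; _∷_)
open import Data.List.Relation.Unary.Any using (Any; here; there; index; any?)
import Data.List.Relation.Unary.Any as Any
import Data.List.Relation.Unary.Any.Properties as AnyP
open import Data.List.Relation.Unary.Unique.Propositional using (Unique)
import Data.List.Relation.Unary.Unique.Propositional.Properties as Unique
open import Data.Nat
  using (ℕ; zero; suc; pred; _+_; _*_; _∸_; _^_; _⊓_; _≤_; _<_; z≤n; s≤s; ⌈_/2⌉; _≤?_; NonZero; >-nonZero)
open import Data.Nat.DivMod using (_/_; _%_; m≡m%n+[m/n]*n; m%n<n; m/n*n≤m; m<n*o⇒m/o<n)
open import Data.Nat.Properties hiding (_≟_)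
open import Data.Nat.Tactic.RingSolver using (solve-∀)
open import Data.Product using (_×_; _,_; ∃; ∃-syntax; proj₁; proj₂)
open import Data.Sum using (_⊎_; inj₁; inj₂; [_,_]′)
open import Data.Vec
  using (Vec; []; _∷_; lookup; replicate; tabulate; toList; updateAt; insertAt; removeAt)
import Data.Vec as Vec
open import Data.Vec.Properties
  using (≡-dec; ∷-injectiveʳ; lookup∘updateAt; lookup∘updateAt′; lookup∘tabulate; tabulate∘lookup;
         tabulate-cong; insertAt-lookup; insertAt-removeAt; removeAt-insertAt; length-toList)
open import Data.Vec.Membership.Propositional using () renaming (_∈_ to _∈ᵥ_)
open import Data.Vec.Membership.Propositional.Properties using (∈-toList⁺; ∈-toList⁻; ∈-tabulate⁺)
import Data.Vec.Relation.Unary.Any as VecAny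
import Data.Vec.Relation.Unary.Any.Properties as VecAnyP
open import Function using (_∘_; id; case_of_)
open import Relation.Binary.PropositionalEquality
  using (_≡_; _≢_; refl; sym; trans; cong; cong₂; subst; subst₂; module ≡-Reasoning)
open import Relation.Nullary using (¬_; Dec; yes; no; ¬?; contradiction)
open import Relation.Nullary.Decidable using (map′; _×-dec_; _⊎-dec_; decidable-stable)

private variable
  n : ℕ

-- Hypercube vertices, coordinate flips and parity.

Cube : ℕ → Set
Cube = Vec Bool

_≟_ : (u v : Cube n) → Dec (u ≡ v)
_≟_ = ≡-dec Bool._≟_

_∈?_ : (u : Cube n) (S : List (Cube n)) → Dec (u ∈ S)
u ∈? S = any? (u ≟_) S

flip : Cube n → Fin n → Cube n
flip u i = updateAt u i not

parity : Cube n → Bool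
parity []      = false
parity (b ∷ v) = b xor parity v

parity-flip : (u : Cube n) (i : Fin n) → parity (flip u i) ≡ not (parity u)
parity-flip (b ∷ u) zero    = sym (Bool.not-distribˡ-xor b (parity u))
parity-flip (b ∷ u) (suc i) =
  trans (cong (b xor_) (parity-flip u i)) (sym (Bool.not-distribʳ-xor b (parity u)))

flip-injective : (u : Cube n) {i j : Fin n} → flip u i ≡ flip u j → i ≡ j
flip-injective (b ∷ u) {zero}  {zero}  _  = refl
flip-injective (b ∷ u) {zero}  {suc j} eq = contradiction (sym (cong Vec.head eq)) (Bool.not-¬ refl)
flip-injective (b ∷ u) {suc i} {zero}  eq = contradiction (cong Vec.head eq) (Bool.not-¬ refl)
flip-injective (b ∷ u) {suc i} {suc j} eq = cong suc (flip-injective u (cong Vec.tail eq))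

adj-flip : (u : Cube n) (i : Fin n) → Adj (Q n) u (flip u i)
adj-flip u i = i , (λ eq → Bool.not-¬ refl (trans eq (lookup∘updateAt i u)))
                 , (λ j j≢i → sym (lookup∘updateAt′ j i j≢i u))

adj⇒flip : (u v : Cube n) → Adj (Q n) u v → ∃[ i ] v ≡ flip u i
adj⇒flip u v (i , ui≢vi , rest) =
  i , trans (sym (tabulate∘lookup v)) (trans (tabulate-cong agree) (tabulate∘lookup (flip u i)))
  where
  agree : ∀ j → lookup v j ≡ lookup (flip u i) j
  agree j with j Fin.≟ i
  ... | yes refl = trans (Bool.¬-not (ui≢vi ∘ sym)) (sym (lookup∘updateAt i u))
  ... | no j≢i   = trans (sym (rest j j≢i)) (sym (lookup∘updateAt′ j i j≢i u))

adj-sym : (u v : Cube n) → Adj (Q n) u v → Adj (Q n) v u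
adj-sym u v (i , ui≢vi , rest) = i , ui≢vi ∘ sym , λ j j≢i → sym (rest j j≢i)

flip-insertAt : (v : Cube n) (i : Fin (suc n)) (b : Bool) →
                flip (insertAt v i b) i ≡ insertAt v i (not b)
flip-insertAt v       zero    b = refl
flip-insertAt (a ∷ v) (suc i) b = cong (a ∷_) (flip-insertAt v i b)

-- Together with `flip-insertAt` this sorts the edges at a vertex: direction `i` leads to its twin
-- in the other half-cube, and direction `punchIn i j` is direction `j` inside its own half.
flip-insertAt-punchIn : (v : Cube n) (i : Fin (suc n)) (b : Bool) (j : Fin n) →
                        flip (insertAt v i b) (punchIn i j) ≡ insertAt (flip v j) i b
flip-insertAt-punchIn v       zero    b j       = refl
flip-insertAt-punchIn (a ∷ v) (suc i) b zero    = refl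
flip-insertAt-punchIn (a ∷ v) (suc i) b (suc j) = cong (a ∷_) (flip-insertAt-punchIn v i b j)

-- Pigeonhole counts on the two parity classes.

pigeonhole : ∀ {m} (f : Fin m → Cube n) → (∀ {i j} → f i ≡ f j → i ≡ j) →
             (L : List (Cube n)) → length L < m → ∃[ i ] f i ∉ L
pigeonhole {m = m} f f-injective L L<m =
  Fin.¬∀⟶∃¬ m (λ i → f i ∈ L) (λ i → f i ∈? L)
    (λ f∈L → <⇒≱ L<m (Fin.injective⇒≤ (index-injective f∈L)))
  where
  index-injective : (f∈L : ∀ i → f i ∈ L) → ∀ {i j} → index (f∈L i) ≡ index (f∈L j) → i ≡ j
  index-injective f∈L {i} {j} eq = f-injective
    (trans (AnyP.lookup-index (f∈L i)) (trans (cong (List.lookup L) eq) (sym (AnyP.lookup-index (f∈L j)))))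

module _ {A : Set} (f : A → Bool) where

  -- One filter serves two partitions of the deleted set: by parity in `count`, by a coordinate in
  -- `half`.
  fibre : Bool → List A → List A
  fibre c = filter (λ x → f x Bool.≟ c)

  length-fibres : ∀ xs → length (fibre true xs) + length (fibre false xs) ≡ length xs
  length-fibres []       = refl
  length-fibres (x ∷ xs) with f x
  ... | true  = cong suc (length-fibres xs)
  ... | false = trans (+-suc _ _) (cong suc (length-fibres xs))

count : Bool → List (Cube n) → ℕ
count c S = length (fibre parity c S)

-- All `n` neighbours of `u` have the parity opposite to `u`, and `S` has too few members of that
-- parity to block them.
neighbour-survives : (S : List (Cube n)) (u : Cube n) →
                     (∀ c → count c S < n) → ∃[ i ] flip u i ∉ S
neighbour-survives S u counts =
  let i , fi∉ = pigeonhole (flip u) (flip-injective u) (fibre parity (not (parity u)) S) (counts _)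
  in  i , λ fi∈S → fi∉ (∈-filter⁺ (λ v → parity v Bool.≟ not (parity u)) fi∈S (parity-flip u i))

flips : Cube n → Cube n → Fin (n + n) → Cube n
flips {n} u v = [ flip u , flip v ]′ ∘ splitAt n

-- Since `u` and `v` differ in parity, no neighbour of one is a neighbour of the other; so there are
-- 2n different neighbours.
flips-injective : (u v : Cube n) → parity v ≡ not (parity u) →
                  ∀ {a b} → flips u v a ≡ flips u v b → a ≡ b
flips-injective {n} u v pv {a} {b} eq =
  trans (sym (Fin.join-splitAt n n a)) (trans (cong (join n n) (go (splitAt n a) (splitAt n b) eq)) (Fin.join-splitAt n n b))
  where
  apart : ∀ i j → flip u i ≢ flip v j
  apart i j e = Bool.not-¬ pv (trans (sym (Bool.not-involutive (parity v)))
    (trans (cong not (sym (parity-flip v j))) (trans (cong (not ∘ parity) (sym e)) (cong not (parity-flip u i)))))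
  go : (x y : Fin n ⊎ Fin n) → [ flip u , flip v ]′ x ≡ [ flip u , flip v ]′ y → x ≡ y
  go (inj₁ i) (inj₁ j) e = cong inj₁ (flip-injective u e)
  go (inj₁ i) (inj₂ j) e = contradiction e (apart i j)
  go (inj₂ i) (inj₁ j) e = contradiction (sym e) (apart j i)
  go (inj₂ i) (inj₂ j) e = cong inj₂ (flip-injective v e)

-- Connectedness of the cube after deleting a list of vertices.

Joined : List (Cube n) → Cube n → Cube n → Set
Joined {n} S = Reach (Q n) (λ a v → v ≡ a) S

Connected : List (Cube n) → Set
Connected S = ∀ u v → u ∉ S → v ∉ S → Joined S u v

module _ {S : List (Cube n)} where

  infixr 5 _⊙_
  _⊙_ : ∀ {u v w} → Joined S u v → Joined S v w → Joined S u w
  here         ⊙ q = q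
  step e v∉S p ⊙ q = step e v∉S (p ⊙ q)

  edge : ∀ {u v} → Adj (Q n) u v → v ∉ S → Joined S u v
  edge e v∉S = step e v∉S here

  flip-edge : ∀ u i → flip u i ∉ S → Joined S u (flip u i)
  flip-edge u i = edge (adj-flip u i)

  -- `Reach` asks every vertex but the first to survive, so survival of the start must be assumed
  -- before it can become the end.
  reverse : ∀ {u v} → u ∉ S → Joined S u v → Joined S v u
  reverse u∉S here           = here
  reverse {u = u} u∉S (step {v = w} e v∉S p) = reverse v∉S p ⊙ edge (adj-sym u w e) u∉S

-- Splitting along a direction, and the induction on the dimension.

module Split (S : List (Cube (suc n))) (i : Fin (suc n)) where

  ins : Cube n → Bool → Cube (suc n)
  ins v b = insertAt v i b

  adj-across : ∀ v b → Adj (Q (suc n)) (ins v (not b)) (ins v b)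
  adj-across v b = subst (Adj (Q (suc n)) (ins v (not b)))
    (trans (flip-insertAt v i (not b)) (cong (ins v) (Bool.not-involutive b))) (adj-flip (ins v (not b)) i)

  adj-within : ∀ v j b → Adj (Q (suc n)) (ins v b) (ins (flip v j) b)
  adj-within v j b = subst (Adj (Q (suc n)) (ins v b)) (flip-insertAt-punchIn v i b j) (adj-flip (ins v b) (punchIn i j))

  -- A vertex w of the other half has a surviving neighbour; if this is not the twin of w, it is
  -- some x in the same half, and the 2 n neighbours of w and x in that half do not all lie over T.
  connect : (T : List (Cube n)) (b : Bool) →
            (∀ c → count c S ≤ n) → length T < n + n → (∀ {u} → u ∈ S → removeAt u i ∈ T) →
            (∀ u v → ins u b ∉ S → ins v b ∉ S → Joined S (ins u b) (ins v b)) →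
            Connected S
  connect T b counts T<2n S↘T half u v u∉S v∉S =
    let u′ , u′∉S , p = to-half u u∉S
        v′ , v′∉S , q = to-half v v∉S
    in  p ⊙ half u′ v′ u′∉S v′∉S ⊙ reverse v∉S q
    where
    -- `T` contains the projection of `S`, so over a vertex outside `T` both twins survive and the
    -- edge between them is usable.
    clear : ∀ {z} → z ∉ T → ∀ c → ins z c ∉ S
    clear {z} z∉T c z∈S = z∉T (subst (_∈ T) (removeAt-insertAt z i c) (S↘T z∈S))

    cross : ∀ {z} → z ∉ T → Joined S (ins z (not b)) (ins z b)
    cross z∉T = edge (adj-across _ b) (clear z∉T b)

    other : ∀ w → ins w (not b) ∉ S → ∃[ v ] (ins v b ∉ S × Joined S (ins w (not b)) (ins v b))
    other w w∉S with neighbour-survives S (ins w (not b)) (s≤s ∘ counts)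
    ... | k , fk∉S with i Fin.≟ k
    ... | yes refl = w , twin∉S , edge (adj-across w b) twin∉S
      where
      twin∉S : ins w b ∉ S
      twin∉S = subst (_∉ S)
        (trans (flip-insertAt w i (not b)) (cong (ins w) (Bool.not-involutive b))) fk∉S
    ... | no i≢k = found (splitAt n a) fa∉T
      where
      x : Cube n
      x = flip w (punchOut i≢k)
      x∉S : ins x (not b) ∉ S
      x∉S = subst (_∉ S)
        (trans (cong (flip _) (sym (Fin.punchIn-punchOut i≢k))) (flip-insertAt-punchIn w i (not b) _)) fk∉S
      hole = pigeonhole (flips w x) (flips-injective w x (parity-flip w _)) T T<2n
      a = proj₁ hole
      fa∉T = proj₂ hole
      found : ∀ s → [ flip w , flip x ]′ s ∉ T →
              ∃[ v ] (ins v b ∉ S × Joined S (ins w (not b)) (ins v b))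
      found (inj₁ j) z∉T = flip w j , clear z∉T b ,
        (edge (adj-within w j _) (clear z∉T _) ⊙ cross z∉T)
      found (inj₂ j) z∉T = flip x j , clear z∉T b ,
        (edge (adj-within w _ _) x∉S ⊙ edge (adj-within x j _) (clear z∉T _) ⊙ cross z∉T)

    to-half : ∀ u → u ∉ S → ∃[ v ] (ins v b ∉ S × Joined S u (ins v b))
    to-half u u∉S with lookup u i Bool.≟ b
    ... | yes refl = removeAt u i , subst (_∉ S) (sym (insertAt-removeAt u i)) u∉S ,
                     subst (Joined S u) (sym (insertAt-removeAt u i)) here
    ... | no ui≢b =
      let v , v∉S , p = other (removeAt u i) (subst (_∉ S) u≡ u∉S)
      in  v , v∉S , subst (λ z → Joined S z (ins v b)) (sym u≡) p
      where
      u≡ : u ≡ ins (removeAt u i) (not b)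
      u≡ = trans (sym (insertAt-removeAt u i)) (cong (ins (removeAt u i)) (Bool.¬-not ui≢b))

  half : Bool → List (Cube n)
  half b = map (λ u → removeAt u i) (fibre (λ u → lookup u i) b S)

  ∈-half⁺ : ∀ {v b} → ins v b ∈ S → v ∈ half b
  ∈-half⁺ {v} {b} v∈S = subst (_∈ half b) (removeAt-insertAt v i b)
    (∈-map⁺ _ (∈-filter⁺ _ v∈S (insertAt-lookup v i b)))

  ∈-half⁻ : ∀ {v b} → v ∈ half b → ins v b ∈ S
  ∈-half⁻ {v} {b} v∈ with u , u∈ , refl ← ∈-map⁻ (λ u → removeAt u i) v∈
                 with u∈S , refl ← ∈-filter⁻ (λ u → lookup u i Bool.≟ b) u∈
                 = subst (_∈ S) (sym (insertAt-removeAt u i)) u∈S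

  length-half : length (half true) + length (half false) ≡ length S
  length-half = trans (cong₂ _+_ (length-map (λ u → removeAt u i) (fibre _ true S))
                                 (length-map (λ u → removeAt u i) (fibre _ false S)))
                      (length-fibres _ S)

  small-half : ∀ b {m o} → length S ≤ m + o → m < length (half b) → length (half (not b)) < o
  small-half b {m} {o} S≤ m< = +-cancelˡ-< m _ _ (<-≤-trans (+-monoˡ-< _ m<)
    (subst (_≤ m + o) (sym (halves b)) S≤))
    where
    halves : ∀ b → length (half b) + length (half (not b)) ≡ length S
    halves true  = length-half
    halves false = trans (+-comm (length (half false)) _) length-half

  join-half : ∀ b → Connected (half b) →
              ∀ u v → ins u b ∉ S → ins v b ∉ S → Joined S (ins u b) (ins v b)
  join-half b conn u v u∉S v∉S = lift (conn u v (u∉S ∘ ∈-half⁻) (v∉S ∘ ∈-half⁻))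
    where
    lift : ∀ {u v} → Joined (half b) u v → Joined S (ins u b) (ins v b)
    lift here           = here
    lift {u} (step {v = x} e x∉ p) with j , refl ← adj⇒flip u x e = step (adj-within _ j b) (x∉ ∘ ∈-half⁺) (lift p)

-- In dimension n = m + 2 the bounds are n - 1 per parity and 2n - 3 in total. At m = 0 the
-- truncated `pred` relaxes the total from 1 to 2, and `connected-with-path` relies on this when it
-- halves the 3-cube.
connected-small : ∀ m (S : List (Cube (2 + m))) → (∀ c → count c S ≤ suc m) →
                  length S ≤ 2 + (m + pred m) → Connected S
connected-small zero S counts _ (a ∷ b ∷ []) (c ∷ d ∷ []) u∉S v∉S
  with c Bool.≟ a | d Bool.≟ b
... | yes refl | yes refl = here
... | yes refl | no d≢b with refl ← Bool.¬-not d≢b = flip-edge (a ∷ b ∷ []) (suc zero) v∉S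
... | no c≢a | yes refl with refl ← Bool.¬-not c≢a = flip-edge (a ∷ b ∷ []) zero v∉S
-- Opposite corners of the square: the parity bound spares one of the two vertices between them.
... | no c≢a | no d≢b with refl ← Bool.¬-not c≢a | refl ← Bool.¬-not d≢b
    with neighbour-survives S (a ∷ b ∷ []) (s≤s ∘ counts)
... | zero     , w∉S = flip-edge (a ∷ b ∷ []) zero w∉S ⊙ flip-edge (not a ∷ b ∷ []) (suc zero) v∉S
... | suc zero , w∉S = flip-edge (a ∷ b ∷ []) (suc zero) w∉S ⊙ flip-edge (a ∷ not b ∷ []) zero v∉S
connected-small (suc m) S counts S≤ =
  by-half (length (half true) ≤? suc m)
  where
  open Split S zero
  from-half : ∀ b → length (half b) ≤ suc m → Connected S
  from-half b half≤ = connect (map (λ u → removeAt u zero) S) b counts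
    (≤-trans (s≤s (≤-trans (≤-reflexive (length-map _ S)) S≤)) (≤-reflexive (cong (2 +_) (sym arith))))
    (∈-map⁺ _)
    (join-half b (connected-small m (half b)
      -- The half has at most n - 1 deleted vertices altogether, for its own dimension n, so the
      -- parity bound is automatic.
      (λ c → ≤-trans (length-filter _ (half b)) half≤)
      (≤-trans half≤ (m≤n⇒m≤1+n (s≤s (m≤m+n m _))))))
    where
    arith : m + suc (suc m) ≡ suc (suc m + m)
    arith = trans (+-suc m (suc m)) (cong suc (+-suc m m))
  by-half : Dec (length (half true) ≤ suc m) → Connected S
  by-half (yes p) = from-half true p
  -- Of at most 2m + 3 deleted vertices, if one half has m + 2 or more, the other has at most m + 1.
  by-half (no ¬p) = from-half false
    (≤-pred (small-half true (≤-trans S≤ (≤-reflexive arith)) (≰⇒> ¬p)))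
    where
    arith : 2 + (suc m + m) ≡ suc m + suc (suc m)
    arith = cong suc (sym (trans (+-suc m (suc m)) (cong suc (+-suc m m))))

-- Provides the `T` of `connect` in the tight case: dropping `p` before mapping loses no value,
-- because `q` has the same image.
shorter-image : ∀ {A : Set} (f : Cube n → A) (S : List (Cube n)) {p q : Cube n} →
                p ∈ S → q ∈ S → p ≢ q → f p ≡ f q →
                ∃[ T ] (length T < length S × (∀ {u} → u ∈ S → f u ∈ T))
shorter-image f S {p} {q} p∈S q∈S p≢q fp≡fq =
  map f S′ , ≤-trans (s≤s (≤-reflexive (length-map f S′))) (filter-notAll _ S (lose p∈S (λ ¬p → ¬p refl))) , covers
  where
  S′ = filter (λ u → ¬? (u ≟ p)) S
  covers : ∀ {u} → u ∈ S → f u ∈ map f S′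
  covers {u} u∈S with u ≟ p
  ... | yes refl = subst (_∈ map f S′) (sym fp≡fq) (∈-map⁺ f (∈-filter⁺ _ q∈S (p≢q ∘ sym)))
  ... | no  u≢p  = ∈-map⁺ f (∈-filter⁺ _ u∈S u≢p)

-- Splitting along the direction of the edge pq makes the projection of S non-injective, and puts
-- the opposite-parity vertices q and r into the same half.
connected-with-path : ∀ m (S : List (Cube (3 + m))) → (∀ c → count c S ≤ 2 + m) →
                      (p : Cube (3 + m)) (i j : Fin (3 + m)) → i ≢ j →
                      p ∈ S → flip p i ∈ S → flip (flip p i) j ∈ S → Connected S
connected-with-path m S counts p i j i≢j p∈S q∈S r∈S =
  by-half (length (half b) ≤? 2 + m)
  where
  open Split S i
  q r : Cube (3 + m)
  q = flip p i
  r = flip q j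
  b = lookup q i
  q′ r′ : Cube (2 + m)
  q′ = removeAt q i
  r′ = flip q′ (punchOut i≢j)

  q′∈ : q′ ∈ half b
  q′∈ = ∈-half⁺ (subst (_∈ S) (sym (insertAt-removeAt q i)) q∈S)
  r′∈ : r′ ∈ half b
  r′∈ = ∈-half⁺ (subst (_∈ S) (trans (cong₂ flip (sym (insertAt-removeAt q i)) (sym (Fin.punchIn-punchOut i≢j)))
                                     (flip-insertAt-punchIn q′ i b _)) r∈S)

  S≤ : length S ≤ (2 + m) + (2 + m)
  S≤ = subst (_≤ (2 + m) + (2 + m)) (length-fibres parity S) (+-mono-≤ (counts true) (counts false))

  p̂≡q̂ : removeAt p i ≡ q′
  p̂≡q̂ = trans (sym (removeAt-insertAt _ i (not (lookup p i))))
    (cong (λ u → removeAt u i) (trans (sym (flip-insertAt (removeAt p i) i _)) (cong (λ u → flip u i) (insertAt-removeAt p i))))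

  p≢q : p ≢ q
  p≢q eq = Bool.not-¬ refl (trans (cong parity eq) (parity-flip p i))

  from-half : ∀ b → (∀ c → count c (half b) ≤ suc m) → length (half b) ≤ 2 + m → Connected S
  from-half b half-counts half≤ =
    let T , T< , covers = shorter-image (λ u → removeAt u i) S p∈S q∈S p≢q p̂≡q̂
    in  connect T b counts (<-≤-trans T< S≤) covers
          (join-half b (connected-small m (half b) half-counts (≤-trans half≤ (s≤s (s≤s (m≤m+n m _))))))

  -- `q′` and `r′` have opposite parities, so each parity class misses one of them and is smaller
  -- than the half.
  mixed : length (half b) ≤ 2 + m → ∀ c → count c (half b) ≤ suc m
  mixed half≤ c = ≤-pred (<-≤-trans (filter-notAll _ (half b) odd-one) half≤)
    where
    odd-one : Any (λ u → parity u ≢ c) (half b)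
    odd-one with parity q′ Bool.≟ c
    ... | no  ≢c   = lose q′∈ ≢c
    ... | yes refl = lose r′∈ (λ eq → Bool.not-¬ refl (trans (sym eq) (parity-flip q′ _)))

  by-half : Dec (length (half b) ≤ 2 + m) → Connected S
  by-half (yes half≤) = from-half b (mixed half≤) half≤
  -- Now the half of `q` and `r` has at least m + 3 of the at most 2m + 4 vertices; the other has at
  -- most m + 1, which bounds both of its parity classes.
  by-half (no ¬half≤) = from-half (not b) (λ c → ≤-trans (length-filter _ (half (not b))) half≤) (m≤n⇒m≤1+n half≤)
    where
    half≤ : length (half (not b)) ≤ suc m
    half≤ = ≤-pred (small-half b S≤ (≰⇒> ¬half≤))

-- Lower bound for cuts by paths.

flip-involutive : (u : Cube n) (i : Fin n) → flip (flip u i) i ≡ u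
flip-involutive (b ∷ u) zero    = cong (_∷ u) (Bool.not-involutive b)
flip-involutive (b ∷ u) (suc i) = cong (b ∷_) (flip-involutive u i)

count-pair : ∀ c (x y : Cube n) zs → parity y ≡ not (parity x) → count c (x ∷ y ∷ zs) ≡ suc (count c zs)
count-pair c x y zs eq = by-case (parity x Bool.≟ c)
  where
  P? = λ (v : Cube _) → parity v Bool.≟ c
  by-case : Dec (parity x ≡ c) → count c (x ∷ y ∷ zs) ≡ suc (count c zs)
  by-case (yes x≡c) = cong length (trans (filter-accept P? {x} {y ∷ zs} x≡c)
    (cong (x ∷_) (filter-reject P? {y} {zs} (λ y≡c → Bool.not-¬ refl (trans (sym y≡c) (trans eq (cong not x≡c)))))))
  by-case (no x≢c) = cong length (trans (filter-reject P? {x} {y ∷ zs} x≢c)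
    (filter-accept P? {y} {zs} (trans eq (sym (Bool.¬-not (x≢c ∘ sym))))))

-- Parity alternates along a path, so each pair taken off the front contributes one vertex to either
-- class; a single vertex left at the end contributes at most one.
count-path : ∀ {j} (vs : Vec (Cube n) j) →
             (∀ (a b : Fin j) → toℕ b ≡ suc (toℕ a) → Adj (Q n) (lookup vs a) (lookup vs b)) →
             ∀ c → count c (toList vs) ≤ ⌈ j /2⌉
count-path []           adj c = z≤n
count-path (x ∷ [])     adj c = length-filter (λ v → parity v Bool.≟ c) (x ∷ [])
count-path (x ∷ y ∷ vs) adj c with i , refl ← adj⇒flip x y (adj zero (suc zero) refl) =
  subst (_≤ _) (sym (count-pair c x y (toList vs) (parity-flip x i)))
    (s≤s (count-path vs (λ a b eq → adj (suc (suc a)) (suc (suc b)) (cong (λ o → suc (suc o)) eq)) c))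

-- Abstracting over `sub` treats both kinds of cut at once: members may be subpaths themselves, or
-- full paths viewed as subpaths.
module _ {m k : ℕ} {A : Set} (sub : A → SubPathIn (Q (3 + m)) k) where

  size : A → ℕ
  size = proj₁ ∘ sub

  cells : A → List (Cube (3 + m))
  cells a = toList (verts (proj₂ (proj₂ (proj₂ (sub a)))))

  count-cells : ∀ c F → count c (concatMap cells F) ≤ length F * ⌈ k /2⌉
  count-cells c []      = z≤n
  count-cells c (a ∷ F) with j , _ , j≤k , path ← sub a = begin
    count c (vs ++ concatMap cells F)           ≡⟨ cong length (filter-++ _ vs (concatMap cells F)) ⟩
    length (fibre parity c vs ++ fibre parity c (concatMap cells F)) ≡⟨ length-++ (fibre parity c vs) ⟩
    count c vs + count c (concatMap cells F)
      ≤⟨ +-mono-≤ (≤-trans (count-path (verts path) (adjacent path) c) (⌈n/2⌉-mono j≤k)) (count-cells c F) ⟩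
    ⌈ k /2⌉ + length F * ⌈ k /2⌉                ∎
    where
    open ≤-Reasoning
    vs = toList (verts path)

  length-cells : ∀ o F → All (λ a → size a ≤ o) F → length (concatMap cells F) ≤ length F * o
  length-cells o []      []       = z≤n
  length-cells o (a ∷ F) (a≤ ∷ F≤) = ≤-trans (≤-reflexive (length-++ (cells a)))
    (+-mono-≤ (≤-trans (≤-reflexive (length-toList (verts (proj₂ (proj₂ (proj₂ (sub a))))))) a≤) (length-cells o F F≤))

  -- Otherwise the survivors stay connected. A member with three vertices triggers
  -- `connected-with-path`; if all members have at most two, the total is at most `length F * 2`,
  -- hence at most n - 1 for n = m + 3, and `connected-small` applies.
  cut-large : 2 ≤ ⌈ k /2⌉ → ∀ F → IsCut (Q (3 + m)) (λ a v → v ∈Sub sub a) F →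
              3 + m ≤ length F * ⌈ k /2⌉
  cut-large 2≤c F cut with 3 + m ≤? length F * ⌈ k /2⌉
  ... | yes large = large
  ... | no ¬large = contradiction cut not-cut
    where
    S : List (Cube (3 + m))
    S = concatMap cells F

    small : length F * ⌈ k /2⌉ ≤ 2 + m
    small = ≤-pred (≰⇒> ¬large)

    counts : ∀ c → count c S ≤ 2 + m
    counts c = ≤-trans (count-cells c F) small

    survives⇒∉ : ∀ {v} → Survives (Q (3 + m)) (λ a v → v ∈Sub sub a) F v → v ∉ S
    survives⇒∉ {v} s v∈S = s (Any.map ∈-toList⁻ (∈-concatMap⁻ cells v∈S))

    ∉⇒survives : ∀ {v} → v ∉ S → Survives (Q (3 + m)) (λ a v → v ∈Sub sub a) F v
    ∉⇒survives {v} v∉S s = v∉S (∈-concatMap⁺ cells (Any.map ∈-toList⁺ s))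

    reach : ∀ {u v} → Joined S u v → Reach (Q (3 + m)) (λ a v → v ∈Sub sub a) F u v
    reach here           = here
    reach (step e v∉S p) = step e (∉⇒survives v∉S) (reach p)

    long-path : ∀ {a} → a ∈ F → 3 ≤ size a → Connected S
    long-path {a} a∈F 3≤ = go 3≤ (verts path) (adjacent path) (distinct path)
      (λ v∈ → ∈-concatMap⁺ cells (lose a∈F (∈-toList⁺ v∈)))
      where
      path = proj₂ (proj₂ (proj₂ (sub a)))
      go : ∀ {j} → 3 ≤ j → (vs : Vec (Cube (3 + m)) j) →
           (∀ (a b : Fin j) → toℕ b ≡ suc (toℕ a) → Adj (Q (3 + m)) (lookup vs a) (lookup vs b)) →
           (∀ (a b : Fin j) → lookup vs a ≡ lookup vs b → a ≡ b) →
           (∀ {v} → v ∈ᵥ vs → v ∈ S) → Connected S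
      go (s≤s (s≤s (s≤s _))) (x ∷ y ∷ z ∷ vs) adj dist vs⊆S
        with i , refl ← adj⇒flip x y (adj zero (suc zero) refl)
        with j , refl ← adj⇒flip y z (adj (suc zero) (suc (suc zero)) refl)
        = connected-with-path m S counts x i j
            -- Equal directions would make the third vertex the first one again.
            (λ { refl → case dist zero (suc (suc zero)) (sym (flip-involutive x i)) of λ () })
            (vs⊆S (VecAny.here refl)) (vs⊆S (VecAny.there (VecAny.here refl)))
            (vs⊆S (VecAny.there (VecAny.there (VecAny.here refl))))

    connected : Connected S
    connected with any? (λ a → 3 ≤? size a) F
    ... | yes p = let a , a∈F , 3≤ = find p in long-path a∈F 3≤
    ... | no ¬p = connected-small (suc m) S counts (begin
      length S         ≤⟨ length-cells 2 F (All.map (≤-pred ∘ ≰⇒>) (¬Any⇒All¬ F ¬p)) ⟩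
      length F * 2     ≤⟨ *-monoʳ-≤ (length F) 2≤c ⟩
      length F * ⌈ k /2⌉ ≤⟨ small ⟩
      2 + m            ≤⟨ +-monoʳ-≤ 2 (m≤n⇒m≤1+n (m≤m+n m m)) ⟩
      2 + (suc m + m)  ∎)
      where open ≤-Reasoning

    not-cut : ¬ IsCut (Q (3 + m)) (λ a v → v ∈Sub sub a) F
    not-cut (inj₁ (u , v , su , sv , ¬reach)) =
      ¬reach (reach (connected u v (survives⇒∉ su) (survives⇒∉ sv)))
    -- A sole survivor is impossible: one of its neighbours survives too, and has the other parity.
    not-cut (inj₂ (u , su , only)) =
      let i , fu∉S = neighbour-survives S u (s≤s ∘ counts)
      in  Bool.not-¬ refl (trans (cong parity (sym (only (flip u i) (∉⇒survives fu∉S)))) (parity-flip u i))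

-- Walks and Hamiltonian tours of the cube.

data Walk {n : ℕ} : Cube n → Cube n → List (Cube n) → Set where
  []  : ∀ {u} → Walk u u []
  _∷_ : ∀ {u v w xs} → Adj (Q n) u v → Walk v w xs → Walk u w (u ∷ xs)

-- The list of a walk leaves out the last vertex, so the junction is not repeated.
walk-++ : ∀ {u v w : Cube n} {xs ys} → Walk u v xs → Walk v w ys → Walk u w (xs ++ ys)
walk-++ []      q = q
walk-++ (e ∷ p) q = e ∷ walk-++ p q

adj-head : ∀ b (v : Cube n) → Adj (Q (suc n)) (b ∷ v) (not b ∷ v)
adj-head b v = adj-flip (b ∷ v) zero

adj-tail : ∀ b (u v : Cube n) → Adj (Q n) u v → Adj (Q (suc n)) (b ∷ u) (b ∷ v)
adj-tail b u v e with i , refl ← adj⇒flip u v e = adj-flip (b ∷ u) (suc i)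

walk-map : ∀ b {u v : Cube n} {xs} → Walk u v xs → Walk (b ∷ u) (b ∷ v) (map (b ∷_) xs)
walk-map b []      = []
walk-map b {u} (_∷_ {v = w} e p) = adj-tail b u w e ∷ walk-map b p

walk-adjacent : ∀ {u v : Cube n} {xs} → Walk u v xs → ∀ a b → toℕ b ≡ suc (toℕ a) →
                Adj (Q n) (List.lookup xs a) (List.lookup xs b)
walk-adjacent (e ∷ (_ ∷ _)) zero    (suc zero) _  = e
walk-adjacent (e ∷ p)       (suc a) (suc b)    eq = walk-adjacent p a b (suc-injective eq)

walk-head : ∀ {u v : Cube n} {xs} → u ≢ v → Walk u v xs → ∃[ ys ] xs ≡ u ∷ ys
walk-head u≢v []      = contradiction refl u≢v
walk-head u≢v (_ ∷ _) = _ , refl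

∉-map : ∀ {a b} → a ≢ b → {v : Cube n} {xs : List (Cube n)} → (a ∷ v) ∉ map (b ∷_) xs
∉-map a≢b p with _ , _ , eq ← ∈-map⁻ (_ ∷_) p = a≢b (cong Vec.head eq)

∈-map-∷ : ∀ {b} {v : Cube n} {xs : List (Cube n)} → (b ∷ v) ∈ map (b ∷_) xs → v ∈ xs
∈-map-∷ p with _ , v∈ , refl ← ∈-map⁻ (_ ∷_) p = v∈

flipHead : Cube n → Cube n
flipHead []      = []
flipHead (b ∷ v) = not b ∷ v

flipHead-involutive : (v : Cube n) → flipHead (flipHead v) ≡ v
flipHead-involutive []      = refl
flipHead-involutive (b ∷ v) = cong (_∷ v) (Bool.not-involutive b)

-- A Hamiltonian path from v to flipHead v, without its last vertex.
tour : Cube n → List (Cube n)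
tour []      = []
tour (b ∷ v) = map (b ∷_) (tour v) ++ (b ∷ flipHead v) ∷ map (not b ∷_) (tour (flipHead v))

tour-walk : (v : Cube n) → Walk v (flipHead v) (tour v)
tour-walk []      = []
tour-walk (b ∷ v) = walk-++ (walk-map b (tour-walk v)) (adj-head b (flipHead v) ∷
  subst (λ w → Walk (not b ∷ flipHead v) (not b ∷ w) (map (not b ∷_) (tour (flipHead v)))) (flipHead-involutive v) (walk-map (not b) (tour-walk (flipHead v))))

length-tour : (v : Cube n) → suc (length (tour v)) ≡ 2 ^ n
length-tour         []      = refl
length-tour {suc n} (b ∷ v) = begin
  suc (length (tour (b ∷ v)))
    ≡⟨ cong suc (length-++ (map (b ∷_) (tour v))) ⟩
  suc (length (map (b ∷_) (tour v))) + suc (length (map (not b ∷_) (tour (flipHead v))))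
    ≡⟨ cong₂ (λ x y → suc x + suc y) (length-map _ (tour v)) (length-map _ (tour (flipHead v))) ⟩
  suc (length (tour v)) + suc (length (tour (flipHead v)))
    ≡⟨ cong₂ _+_ (length-tour v) (trans (length-tour (flipHead v)) (sym (+-identityʳ _))) ⟩
  2 ^ suc n ∎
  where open ≡-Reasoning

-- Secures both later junctions: in `tour` the omitted endpoint is inserted between the two halves,
-- and in `path` it is the vertex that the zigzag has already used.
flipHead∉tour : (v : Cube n) → flipHead v ∉ tour v
flipHead∉tour (b ∷ v) p with ∈-++⁻ (map (b ∷_) (tour v)) p
... | inj₁ q           = ∉-map (Bool.not-¬ refl ∘ sym) q
... | inj₂ (here eq)   = Bool.not-¬ refl (sym (cong Vec.head eq))
flipHead∉tour (b ∷ []) p | inj₂ (there ())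
flipHead∉tour (b ∷ v@(_ ∷ _)) p | inj₂ (there q) =
  flipHead∉tour (flipHead v) (subst (_∈ tour (flipHead v)) (sym (flipHead-involutive v)) (∈-map-∷ q))

tour-unique : (v : Cube n) → Unique (tour v)
tour-unique []      = []
tour-unique (b ∷ v) = Unique.++⁺ (Unique.map⁺ ∷-injectiveʳ (tour-unique v))
  (All.tabulate (λ { w∈ refl → ∉-map (Bool.not-¬ refl) w∈ }) ∷ Unique.map⁺ ∷-injectiveʳ (tour-unique (flipHead v)))
  λ { (p , here refl) → flipHead∉tour v (∈-map-∷ p)
    ; (p , there q)   → disjoint p q }
  where
  disjoint : ∀ {w} → w ∈ map (b ∷_) (tour v) → w ∉ map (not b ∷_) (tour (flipHead v))
  disjoint p q with _ , _ , refl ← ∈-map⁻ (b ∷_) p = ∉-map (Bool.not-¬ refl) q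

-- The long path through all neighbours of the origin.

origin : Cube n
origin = replicate _ false

-- Runs through all neighbours of the origin, each at an even position; the last of them,
-- true ∷ origin, is left out.
zigzag : ∀ n → List (Cube (suc n))
zigzag zero    = []
zigzag (suc n) = map (false ∷_) (zigzag n) ++ (false ∷ true ∷ origin) ∷ (true ∷ true ∷ origin) ∷ []

zigzag-walk : ∀ n → ∃[ u ] Walk u (true ∷ origin) (zigzag n)
zigzag-walk zero    = _ , []
zigzag-walk (suc n) = let u , p = zigzag-walk n in
  false ∷ u , walk-++ (walk-map false p) (adj-head false (true ∷ origin) ∷ adj-flip (true ∷ true ∷ origin) (suc zero) ∷ [])

length-zigzag : ∀ n → length (zigzag n) ≡ n + n
length-zigzag zero    = refl
length-zigzag (suc n) = begin
  length (zigzag (suc n))                        ≡⟨ length-++ (map (false ∷_) (zigzag n)) ⟩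
  length (map (false ∷_) (zigzag n)) + 2         ≡⟨ cong (_+ 2) (trans (length-map _ (zigzag n)) (length-zigzag n)) ⟩
  n + n + 2                                      ≡⟨ +-comm (n + n) 2 ⟩
  2 + (n + n)                                    ≡⟨ cong suc (sym (+-suc n n)) ⟩
  suc n + suc n                                  ∎
  where open ≡-Reasoning

zigzag-upper : ∀ n {v : Cube n} → (true ∷ v) ∈ zigzag n → v ≡ flipHead origin × v ≢ origin
zigzag-upper (suc n) p with ∈-++⁻ (map (false ∷_) (zigzag n)) p
... | inj₁ q                    = contradiction q (∉-map λ ())
... | inj₂ (there (here refl))  = refl , λ ()

zigzag-unique : ∀ n → Unique (zigzag n)
zigzag-unique zero    = []
zigzag-unique (suc n) = Unique.++⁺ (Unique.map⁺ ∷-injectiveʳ (zigzag-unique n))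
  (((λ ()) ∷ []) ∷ [] ∷ [])
  λ { (p , here refl)         → proj₂ (zigzag-upper n (∈-map-∷ p)) refl
    ; (p , there (here refl)) → ∉-map (λ ()) p }

origin∉zigzag : ∀ n → origin ∉ zigzag n
origin∉zigzag (suc n) p with ∈-++⁻ (map (false ∷_) (zigzag n)) p
... | inj₁ q                   = origin∉zigzag n (∈-map-∷ q)
... | inj₂ (here ())
... | inj₂ (there (here ()))

path : ∀ n → List (Cube (suc n))
path n = zigzag n ++ map (true ∷_) (tour origin)

path-walk : ∀ n → ∃[ u ] ∃[ v ] Walk u v (path n)
path-walk n = let u , p = zigzag-walk n in _ , _ , walk-++ p (walk-map true (tour-walk origin))

path-unique : ∀ n → Unique (path n)
path-unique n = Unique.++⁺ (zigzag-unique n) (Unique.map⁺ ∷-injectiveʳ (tour-unique origin)) disjoint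
  where
  disjoint : ∀ {v} → ¬ (v ∈ zigzag n × v ∈ map (true ∷_) (tour origin))
  disjoint (p , q) with w , w∈ , refl ← ∈-map⁻ (true ∷_) q
    with refl , _ ← zigzag-upper n p = flipHead∉tour origin w∈

origin∉path : ∀ n → origin ∉ path n
origin∉path n p with ∈-++⁻ (zigzag n) p
... | inj₁ q = origin∉zigzag n q
... | inj₂ q = ∉-map (λ ()) q

length-path : ∀ n → suc (length (path n)) ≡ (n + n) + 2 ^ n
length-path n = begin
  suc (length (path n))                              ≡⟨ cong suc (length-++ (zigzag n)) ⟩
  suc (length (zigzag n) + length (map (true ∷_) (tour {n} origin)))
    ≡⟨ cong₂ (λ x y → suc (x + y)) (length-zigzag n) (length-map _ (tour {n} origin)) ⟩
  suc (n + n + length (tour {n} origin))             ≡⟨ sym (+-suc (n + n) _) ⟩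
  n + n + suc (length (tour {n} origin))             ≡⟨ cong (n + n +_) (length-tour {n} origin) ⟩
  n + n + 2 ^ n                                      ∎
  where open ≡-Reasoning

-- Positions of the neighbours along the path.

data At {A : Set} (x : A) : List A → ℕ → Set where
  here  : ∀ {xs} → At x (x ∷ xs) 0
  there : ∀ {y xs p} → At x xs p → At x (y ∷ xs) (suc p)

module _ {A : Set} {x : A} where

  at-++ˡ : ∀ {xs p} ys → At x xs p → At x (xs ++ ys) p
  at-++ˡ ys here      = here
  at-++ˡ ys (there h) = there (at-++ˡ ys h)

  at-++ʳ : ∀ xs {ys p} → At x ys p → At x (xs ++ ys) (length xs + p)
  at-++ʳ []       h = h
  at-++ʳ (y ∷ xs) h = there (at-++ʳ xs h)

  at-map : ∀ {B : Set} (f : A → B) {xs p} → At x xs p → At (f x) (map f xs) p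
  at-map f here      = here
  at-map f (there h) = there (at-map f h)

  at-lookup : ∀ {xs p} → At x xs p → ∀ i → toℕ i ≡ p → List.lookup xs i ≡ x
  at-lookup here      zero    _  = refl
  at-lookup (there h) (suc i) eq = at-lookup h i (suc-injective eq)

  at-< : ∀ {xs p} → At x xs p → p < length xs
  at-< here      = s≤s z≤n
  at-< (there h) = s≤s (at-< h)

-- Raising the dimension prefixes `false` and appends at the end, so the old neighbours keep their
-- positions and the new one comes at `length (zigzag n)`. The endpoint restored before `rest`
-- becomes the first appended vertex at the next stage.
zigzag-position : ∀ n (i : Fin (suc n)) rest →
  ∃[ j ] (j ≤ n × At (flip origin i) (zigzag n ++ (true ∷ origin) ∷ rest) (j + j))
zigzag-position n       zero    rest = n , ≤-refl ,
  subst (At _ _) (trans (+-identityʳ _) (length-zigzag n)) (at-++ʳ (zigzag n) here)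
zigzag-position (suc n) (suc i) rest =
  let j , j≤n , h = zigzag-position n i []
  in  j , m≤n⇒m≤1+n j≤n ,
      subst (λ xs → At _ xs (j + j)) reassociate (at-++ˡ ((true ∷ true ∷ origin) ∷ (true ∷ origin) ∷ rest) (at-map (false ∷_) h))
  where
  reassociate : map (false ∷_) (zigzag n ++ (true ∷ origin) ∷ []) ++ (true ∷ true ∷ origin) ∷ (true ∷ origin) ∷ rest
              ≡ zigzag (suc n) ++ (true ∷ origin) ∷ rest
  reassociate = trans (cong (_++ (true ∷ true ∷ origin) ∷ (true ∷ origin) ∷ rest) (map-++ (false ∷_) (zigzag n) _))
    (trans (++-assoc (map (false ∷_) (zigzag n)) _ _) (sym (++-assoc (map (false ∷_) (zigzag n)) _ _)))

path-position : ∀ n → 1 ≤ n → (i : Fin (suc n)) → ∃[ j ] (j ≤ n × At (flip origin i) (path n) (j + j))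
-- In positive dimension the tour is non-empty and starts at `origin`, which supplies the neighbour
-- `true ∷ origin` left out of the zigzag.
path-position (suc n) _ i with rest , eq ← walk-head (λ ()) (tour-walk {suc n} origin) =
  subst (λ xs → ∃[ j ] (j ≤ suc n × At (flip origin i) (zigzag (suc n) ++ map (true ∷_) xs) (j + j)))
    (sym eq) (zigzag-position (suc n) i (map (true ∷_) rest))

-- Windows of consecutive vertices as paths.

unique-lookup : ∀ {A : Set} {xs : List A} → Unique xs →
                ∀ i j → List.lookup xs i ≡ List.lookup xs j → i ≡ j
unique-lookup (x∉ ∷ u) zero    zero    _  = refl
unique-lookup (x∉ ∷ u) zero    (suc j) eq = contradiction eq (All.lookup x∉ (∈-lookup j))
unique-lookup (x∉ ∷ u) (suc i) zero    eq = contradiction (sym eq) (All.lookup x∉ (∈-lookup i))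
unique-lookup (x∉ ∷ u) (suc i) (suc j) eq = cong suc (unique-lookup u i j eq)

module Window {u v : Cube n} {xs : List (Cube n)} (walk : Walk u v xs) (unique : Unique xs)
              (s k : ℕ) (fits : s + k ≤ length xs) where

  position : Fin k → Fin (length xs)
  position a = fromℕ< (<-≤-trans (+-monoʳ-< s (Fin.toℕ<n a)) fits)

  toℕ-position : ∀ a → toℕ (position a) ≡ s + toℕ a
  toℕ-position a = Fin.toℕ-fromℕ< _

  vertex : Fin k → Cube n
  vertex = List.lookup xs ∘ position

  window : PathIn (Q n) k
  window = record
    { verts    = tabulate vertex
    ; adjacent = λ a b eq → subst₂ (Adj (Q n)) (sym (lookup∘tabulate vertex a)) (sym (lookup∘tabulate vertex b))
        (walk-adjacent walk (position a) (position b)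
          (trans (toℕ-position b) (trans (cong (s +_) eq) (trans (+-suc s _) (cong suc (sym (toℕ-position a)))))))
    ; distinct = λ a b eq → Fin.toℕ-injective (+-cancelˡ-≡ s _ _
        (trans (sym (toℕ-position a)) (trans (cong toℕ (unique-lookup unique (position a) (position b)
          (trans (sym (lookup∘tabulate vertex a)) (trans eq (lookup∘tabulate vertex b))))) (toℕ-position b))))
    }

  ∈-window⁺ : ∀ {x p} → At x xs p → s ≤ p → p < s + k → x ∈ᵥ verts window
  ∈-window⁺ {x} {p} h s≤p p< = subst (_∈ᵥ verts window)
    (at-lookup h (position a) (trans (toℕ-position a) (trans (cong (s +_) (Fin.toℕ-fromℕ< _)) (m+[n∸m]≡n s≤p))))
    (∈-tabulate⁺ vertex a)
    where
    a : Fin k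
    a = fromℕ< (+-cancelˡ-< s (p ∸ s) k (subst (_< s + k) (sym (m+[n∸m]≡n s≤p)) p<))

  ∈-window⁻ : ∀ {x} → x ∈ᵥ verts window → x ∈ xs
  ∈-window⁻ x∈ with a , refl ← VecAnyP.tabulate⁻ x∈ = ∈-lookup (position a)

-- Upper bound: isolating the origin.

search : {P : Cube n → Set} → (∀ v → Dec (P v)) → Dec (∃ P)
search {zero}  P? = map′ (λ p → [] , p) (λ { ([] , p) → p }) (P? [])
search {suc n} P? = map′
  (λ { (inj₁ (v , p)) → true ∷ v , p ; (inj₂ (v , p)) → false ∷ v , p })
  (λ { (true ∷ v , p) → inj₁ (v , p) ; (false ∷ v , p) → inj₂ (v , p) })
  (search (λ v → P? (true ∷ v)) ⊎-dec search (λ v → P? (false ∷ v)))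

-- Every walk leaving `u` is stopped at its first step. Exhaustive search decides whether another
-- survivor exists, which makes the cut `Disconnected`, or `u` is alone, which makes it `Trivial`.
isolating-cut : {A : Set} (memb : A → Cube n → Set) → (∀ v a → Dec (memb a v)) → (F : List A) (u : Cube n) →
                Survives (Q n) memb F u → (∀ i → ¬ Survives (Q n) memb F (flip u i)) → IsCut (Q n) memb F
isolating-cut {n} memb memb? F u su isolated
  with search (λ v → ¬? (any? (memb? v) F) ×-dec ¬? (v ≟ u))
... | yes (v , sv , v≢u) = inj₁ (u , v , su , sv , unreachable v≢u)
  where
  unreachable : ∀ {v} → v ≢ u → ¬ Reach (Q n) memb F u v
  unreachable v≢u here = v≢u refl
  unreachable v≢u (step {v = w} e sw _) with i , refl ← adj⇒flip u w e = isolated i sw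
... | no none = inj₂ (u , su , λ v sv → decidable-stable (v ≟ u) (λ v≢u → none (v , sv , v≢u)))

-- Here `n` is the dimension minus one, `c` stands for `⌈ k /2⌉` and `M` is the number of paths.
module _ (n k c M : ℕ) (1≤n : 1 ≤ n) (k≤2^n : k ≤ 2 ^ n) .{{_ : NonZero c}}
         (2c≤1+k : c + c ≤ suc k) (n<Mc : n < M * c) where

  -- The path has 2n + 2^n - 1 vertices, at least 2^n as n is positive; this is where the upper
  -- bound on `k` enters.
  k≤length : k ≤ length (path n)
  k≤length = ≤-pred (≤-trans (+-mono-≤ (≤-trans 1≤n (m≤m+n n n)) k≤2^n) (≤-reflexive (sym (length-path n))))

  -- Windows start 2c apart, that is, c neighbours apart; the minimum shifts a window back if it
  -- would run past the end of the path.
  start : ℕ → ℕ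
  start t = t * (c + c) ⊓ (length (path n) ∸ k)

  start-fits : ∀ t → start t + k ≤ length (path n)
  start-fits t = ≤-trans (+-monoˡ-≤ k (m⊓n≤n (t * (c + c)) _)) (≤-reflexive (m∸n+n≡m k≤length))

  module Segment (t : ℕ) =
    Window (proj₂ (proj₂ (path-walk n))) (path-unique n) (start t) k (start-fits t)

  segments : List (PathIn (Q (suc n)) k)
  segments = map Segment.window (upTo M)

  length-segments : length segments ≡ M
  length-segments = trans (length-map Segment.window (upTo M)) (length-upTo M)

  neighbour-covered : ∀ i → Any (λ p → flip origin i ∈ᵥ verts p) segments
  neighbour-covered i with j , j≤n , h ← path-position n 1≤n i =
    AnyP.map⁺ (lose (∈-upTo⁺ (m<n*o⇒m/o<n (≤-<-trans j≤n n<Mc))) (Segment.∈-window⁺ t h start≤ <end))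
    where
    -- The neighbour at position 2j is number j, and each window is responsible for c of them.
    t = j / c
    tc+tc : t * (c + c) ≡ t * c + t * c
    tc+tc = *-distribˡ-+ t c c
    start≤ : start t ≤ j + j
    start≤ = ≤-trans (m⊓n≤m _ _) (≤-trans (≤-reflexive tc+tc) (+-mono-≤ (m/n*n≤m j c) (m/n*n≤m j c)))
    j< : j < t * c + c
    j< = begin-strict
      j               ≡⟨ m≡m%n+[m/n]*n j c ⟩
      j % c + t * c   <⟨ +-monoˡ-< (t * c) (m%n<n j c) ⟩
      c + t * c       ≡⟨ +-comm c _ ⟩
      t * c + c       ∎
      where open ≤-Reasoning
    -- The last neighbour due to window t is at 2tc + 2c - 2, which is at most 2tc + k - 1: a window
    -- of odd length both starts and ends at an even position.
    unclamped : j + j < t * (c + c) + k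
    unclamped = ≤-pred (begin
      suc (suc (j + j))             ≡⟨ cong suc (sym (+-suc j j)) ⟩
      suc j + suc j                 ≤⟨ +-mono-≤ j< j< ⟩
      (t * c + c) + (t * c + c)     ≡⟨ [m+n]+[m+n] (t * c) c ⟩
      (t * c + t * c) + (c + c)     ≤⟨ +-monoʳ-≤ (t * c + t * c) 2c≤1+k ⟩
      (t * c + t * c) + suc k       ≡⟨ cong (_+ suc k) (sym tc+tc) ⟩
      t * (c + c) + suc k           ≡⟨ +-suc _ k ⟩
      suc (t * (c + c) + k)         ∎)
      where
      open ≤-Reasoning
      [m+n]+[m+n] : ∀ m n → (m + n) + (m + n) ≡ (m + m) + (n + n)
      [m+n]+[m+n] = solve-∀
    <end : j + j < start t + k
    <end with ⊓-sel (t * (c + c)) (length (path n) ∸ k)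
    ... | inj₁ eq = subst (λ s → j + j < s + k) (sym eq) unclamped
    -- A window shifted back ends where the path ends, beyond any position on it.
    ... | inj₂ eq = subst (λ s → j + j < s + k) (sym eq) (subst (j + j <_) (sym (m∸n+n≡m k≤length)) (at-< h))

  origin-free : ¬ Any (λ p → origin ∈ᵥ verts p) segments
  origin-free blocked =
    let t , _ , o∈ = find (AnyP.map⁻ blocked) in origin∉path n (Segment.∈-window⁻ t o∈)

  cut-exists : {A : Set} (sub : A → SubPathIn (Q (suc n)) k) (mk : PathIn (Q (suc n)) k → A) →
               (∀ p v → (v ∈Sub sub (mk p)) ≡ (v ∈ᵥ verts p)) →
               ∃[ F ] (IsCut (Q (suc n)) (λ a v → v ∈Sub sub a) F × length F ≡ M)
  cut-exists sub mk same =
    map mk segments ,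
    isolating-cut _ (λ v a → VecAny.any? (v ≟_) _) (map mk segments) origin
      (λ blocked → origin-free (Any.map (λ {p} → subst id (same p origin)) (AnyP.map⁻ blocked)))
      (λ i free → free (AnyP.map⁺ (Any.map (λ {p} → subst id (sym (same p (flip origin i)))) (neighbour-covered i)))) ,
    trans (length-map mk segments) length-segments

-- Arithmetic of the formula.

halve : ∀ k → (k % 2 ≡ 0 × k ≡ ⌈ k /2⌉ + ⌈ k /2⌉) ⊎ (k % 2 ≡ 1 × suc k ≡ ⌈ k /2⌉ + ⌈ k /2⌉)
halve zero          = inj₁ (refl , refl)
halve (suc zero)    = inj₂ (refl , refl)
halve (suc (suc k)) with halve k
... | inj₁ (r , eq) = inj₁ (r , cong suc (trans (cong suc eq) (sym (+-suc _ _))))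
... | inj₂ (r , eq) = inj₂ (r , cong suc (trans (cong suc eq) (sym (+-suc _ _))))

2⌈k/2⌉≤1+k : ∀ k → ⌈ k /2⌉ + ⌈ k /2⌉ ≤ suc k
2⌈k/2⌉≤1+k k with halve k
... | inj₁ (_ , eq) = ≤-trans (≤-reflexive (sym eq)) (n≤1+n k)
... | inj₂ (_ , eq) = ≤-reflexive (sym eq)

-- Twice `⌈ k /2⌉` is `k` for even `k` and `suc k` for odd `k`, the divisor in either case.
expected≡ : ∀ n k → expected n k ≡ ceilDiv (2 * n) (⌈ k /2⌉ + ⌈ k /2⌉)
expected≡ n k with k % 2 | halve k
... | 0           | inj₁ (_ , eq) = cong (ceilDiv (2 * n)) eq
... | 1           | inj₂ (_ , eq) = cong (ceilDiv (2 * n)) eq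

ceilDiv-least : ∀ m d N → m ≤ N * suc d → ceilDiv m (suc d) ≤ N
ceilDiv-least m d N m≤ = ≤-pred (m<n*o⇒m/o<n (begin-strict
  m + d              ≤⟨ +-monoˡ-≤ d m≤ ⟩
  N * suc d + d      <⟨ n<1+n _ ⟩
  suc (N * suc d + d) ≡⟨ cong suc (+-comm _ d) ⟩
  suc N * suc d      ∎))
  where open ≤-Reasoning

≤-ceilDiv : ∀ m d → m ≤ ceilDiv m (suc d) * suc d
≤-ceilDiv m d = +-cancelʳ-≤ d m _ (begin
  m + d                                        ≡⟨ m≡m%n+[m/n]*n (m + d) (suc d) ⟩
  (m + d) % suc d + ceilDiv m (suc d) * suc d  ≤⟨ +-monoˡ-≤ _ (≤-pred (m%n<n (m + d) (suc d))) ⟩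
  d + ceilDiv m (suc d) * suc d                ≡⟨ +-comm d _ ⟩
  ceilDiv m (suc d) * suc d + d                ∎)
  where open ≤-Reasoning

-- Cancelling the factor 2, this and `≤-expected` characterise the formula as a least `N`, the form
-- in which both bounds deliver it.
expected-least : ∀ n k N → 1 ≤ ⌈ k /2⌉ → n ≤ N * ⌈ k /2⌉ → expected n k ≤ N
expected-least n k N 1≤c n≤Nc rewrite expected≡ n k with ⌈ k /2⌉
... | suc c = ceilDiv-least (2 * n) (c + suc c) N (≤-trans (*-monoʳ-≤ 2 n≤Nc) (≤-reflexive (twice N (suc c))))
  where
  twice : ∀ N c → 2 * (N * c) ≡ N * (c + c)
  twice = solve-∀

≤-expected : ∀ n k → 1 ≤ ⌈ k /2⌉ → n ≤ expected n k * ⌈ k /2⌉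
≤-expected n k 1≤c rewrite expected≡ n k with ⌈ k /2⌉
... | suc c = *-cancelˡ-≤ 2 (≤-trans (≤-ceilDiv (2 * n) (c + suc c)) (≤-reflexive (twice (ceilDiv (2 * n) (suc c + suc c)) (suc c))))
  where
  twice : ∀ N c → N * (c + c) ≡ 2 * (N * c)
  twice = solve-∀

-- `mk` makes members from the windows for the upper bound; `sub` reads members as subpaths for the
-- lower bound. One of the two is `id` in each of the two connectivities.
connectivity : ∀ n k → 3 ≤ n → 3 ≤ k → k ≤ 2 ^ (n ∸ 1) →
               {A : Set} (sub : A → SubPathIn (Q n) k) (mk : PathIn (Q n) k → A) →
               (∀ p v → (v ∈Sub sub (mk p)) ≡ (v ∈ᵥ verts p)) →
               IsMinimum (IsCut (Q n) (λ a v → v ∈Sub sub a)) (expected n k)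
connectivity (suc (suc (suc m))) k (s≤s (s≤s (s≤s _))) 3≤k k≤ sub mk same =
  cut-exists (2 + m) k ⌈ k /2⌉ (expected (3 + m) k) (s≤s z≤n) k≤ {{>-nonZero 1≤c}} (2⌈k/2⌉≤1+k k)
    (≤-expected (3 + m) k 1≤c) sub mk same ,
  λ F cut → expected-least (3 + m) k (length F) 1≤c (cut-large sub 2≤c F cut)
  where
  2≤c : 2 ≤ ⌈ k /2⌉
  2≤c = ⌈n/2⌉-mono 3≤k
  1≤c : 1 ≤ ⌈ k /2⌉
  1≤c = ≤-trans (s≤s z≤n) 2≤c

theorem13 : ∀ (n k : ℕ) → 3 ≤ n → 3 ≤ k → k ≤ 2 ^ (n ∸ 1)
    → SubstructureConnectivity (Q n) k (expected n k)
    × StructureConnectivity (Q n) k (expected n k)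
theorem13 n k 3≤n 3≤k k≤ =
  connectivity n k 3≤n 3≤k k≤ id whole (λ _ _ → refl) ,
  connectivity n k 3≤n 3≤k k≤ whole id (λ _ _ → refl)
  where
  whole : PathIn (Q n) k → SubPathIn (Q n) k
  whole p = k , ≤-trans (s≤s z≤n) 3≤k , ≤-refl , p
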